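{- For every $n$, the $(\wedge,\to)$-homomorphism $h:F_{\wedge,\to}(n)\to\mathcal U(U(n)_{\wedge,\to})$ extending $p_i\mapsto\{x\in U(n)_{\wedge,\to}: x\models p_i\}$ is injective. In particular, $F_{\wedge,\to}(n)$ is finite, and therefore the variety of implicative meet-semilattices is locally finite.
   Context: An implicative meet-semilattice is $(A,\wedge,\to)$ with $(A,\wedge)$ a meet-semilattice and $a\wedge b\le c\iff a\le b\to c$. $F_{\wedge,\to}(n)$ is the free implicative meet-semilattice on $p_1,\dots,p_n$, equivalently the $(\wedge,\to)$-formulas in $p_1,\dots,p_n$ modulo IPC-equivalence. $\mathcal U(X)$ is the Heyting algebra of up-sets of a poset $X$. Models are posets with an order-preserving colouring $c:M\to\{0,1\}^n$ and intuitionistic Kripke semantics ($x\models p_i$ iff $c(x)_i=1$). A point $x$ is separated if for some variable $q$, $x\not\models q$ but all $y>x$ satisfy $q$; $M^s$ denotes the separated points with restricted order and colouring. $U(n)$ is the $n$-universal model: the generated submodel of the canonical model of IPC on $p_1,\dots,p_n$ (prime filters of the free Heyting algebra ordered by inclusion, $c(x)_i=1$ iff $p_i\in x$) consisting of points with finite up-set. For every model of finite depth there is a unique p-morphism (order- and colour-preserving map with the back condition) into $U(n)$; $U(n)^s$ has finite depth, and $U(n)_{\wedge,\to}$ denotes the image of the unique p-morphism $U(n)^s\to U(n)$, a generated submodel of $U(n)$. -}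

module Defs where

open import Level using (Level; 0ℓ; suc; _⊔_; Lift; lift; lower)
open import Algebra.Core using (Op₂)
open import Data.Bool.Base as Bool using (Bool; true; false)
open import Data.Empty.Polymorphic using (⊥; ⊥-elim)
open import Data.Fin.Base using (Fin)
open import Data.List.Base using (List; []; _∷_)
open import Data.List.Membership.Propositional using (_∈_)
open import Data.List.Relation.Unary.Any using (here; there)
import Data.List.Relation.Unary.Enumerates.Setoid as Enumerates
open import Data.Nat.Base using (ℕ)
open import Data.Product.Base as Prod using (Σ; Σ-syntax; ∃; ∃-syntax; _×_; _,_; proj₁; proj₂; swap)
open import Data.Sum.Base as Sum using (_⊎_; inj₁; inj₂; [_,_])
open import Data.Unit.Polymorphic using (⊤; tt)
open import Function.Base using (_∘_; id)
open import Relation.Binary.Bundles using (Setoid; Poset)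
open import Relation.Binary.Core using (Rel)
open import Relation.Binary.Lattice using
  (Exponential; IsMeetSemilattice; MeetSemilattice; HeytingAlgebra)
open import Relation.Binary.Morphism.Bundles using (PosetHomomorphism)
open import Relation.Binary.PropositionalEquality using (_≡_; refl; sym; trans)
import Relation.Binary.Construct.On as On
import Relation.Binary.Properties.Poset as PosetProperties
open import Relation.Nullary.Negation using (¬_)
open import Relation.Unary using (Pred)

private variable
  a ℓ c ℓ₁ ℓ₂ c′ ℓ₁′ ℓ₂′ : Level

Finite : Setoid a ℓ → Set (a ⊔ ℓ)
Finite S = ∃[ xs ] Enumerates.IsEnumeration S xs

record ImplicativeMeetSemilattice c ℓ₁ ℓ₂ : Set (suc (c ⊔ ℓ₁ ⊔ ℓ₂)) where
  infix  4 _≈_ _≤_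
  infixr 5 _⇨_
  infixr 7 _∧_
  field
    Carrier           : Set c
    _≈_               : Rel Carrier ℓ₁
    _≤_               : Rel Carrier ℓ₂
    _∧_               : Op₂ Carrier
    _⇨_               : Op₂ Carrier
    isMeetSemilattice : IsMeetSemilattice _≈_ _≤_ _∧_
    exponential       : Exponential _≤_ _∧_ _⇨_

  meetSemilattice : MeetSemilattice c ℓ₁ ℓ₂
  meetSemilattice = record { isMeetSemilattice = isMeetSemilattice }

  open MeetSemilattice meetSemilattice public
    hiding (Carrier; _≈_; _≤_; _∧_; isMeetSemilattice)

  setoid : Setoid c ℓ₁
  setoid = record { isEquivalence = isEquivalence }

record Homomorphism (A : ImplicativeMeetSemilattice c ℓ₁ ℓ₂)
                    (B : ImplicativeMeetSemilattice c′ ℓ₁′ ℓ₂′) :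
                    Set (c ⊔ ℓ₁ ⊔ c′ ⊔ ℓ₁′) where
  private
    module A = ImplicativeMeetSemilattice A
    module B = ImplicativeMeetSemilattice B
  field
    ⟦_⟧    : A.Carrier → B.Carrier
    cong   : ∀ {x y} → x A.≈ y → ⟦ x ⟧ B.≈ ⟦ y ⟧
    ∧-homo : ∀ x y → ⟦ x A.∧ y ⟧ B.≈ ⟦ x ⟧ B.∧ ⟦ y ⟧
    ⇨-homo : ∀ x y → ⟦ x A.⇨ y ⟧ B.≈ ⟦ x ⟧ B.⇨ ⟦ y ⟧

∧⇨-reduct : HeytingAlgebra c ℓ₁ ℓ₂ → ImplicativeMeetSemilattice c ℓ₁ ℓ₂
∧⇨-reduct H = record
  { isMeetSemilattice = record { isPartialOrder = isPartialOrder ; infimum = infimum }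
  ; exponential       = exponential
  } where open HeytingAlgebra H

module _ (A : ImplicativeMeetSemilattice c ℓ₁ ℓ₂) where
  open ImplicativeMeetSemilattice A

  data Generated {k : ℕ} (g : Fin k → Carrier) : Pred Carrier (c ⊔ ℓ₁) where
    gen  : ∀ i → Generated g (g i)
    meet : ∀ {x y} → Generated g x → Generated g y → Generated g (x ∧ y)
    impl : ∀ {x y} → Generated g x → Generated g y → Generated g (x ⇨ y)
    resp : ∀ {x y} → x ≈ y → Generated g x → Generated g y

  FinitelyGenerated : Set (c ⊔ ℓ₁)
  FinitelyGenerated = Σ[ k ∈ ℕ ] Σ[ g ∈ (Fin k → Carrier) ] (∀ x → Generated g x)

LocallyFinite-IMS : ∀ c ℓ₁ ℓ₂ → Set (suc (c ⊔ ℓ₁ ⊔ ℓ₂))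
LocallyFinite-IMS c ℓ₁ ℓ₂ =
  (A : ImplicativeMeetSemilattice c ℓ₁ ℓ₂) →
  FinitelyGenerated A → Finite (ImplicativeMeetSemilattice.setoid A)

module _ (P : Poset c ℓ₁ ℓ₂) where
  open Poset P

  record UpSet : Set (suc (c ⊔ ℓ₂)) where
    constructor mkUpSet
    field
      Mem    : Pred Carrier (c ⊔ ℓ₂)
      closed : ∀ {x y} → x ≤ y → Mem x → Mem y

  open UpSet

  UpSets : HeytingAlgebra (suc (c ⊔ ℓ₂)) (c ⊔ ℓ₂) (c ⊔ ℓ₂)
  UpSets = record
    { Carrier = UpSet
    ; _≈_     = λ V W → (∀ x → Mem V x → Mem W x) × (∀ x → Mem W x → Mem V x)
    ; _≤_     = λ V W → ∀ x → Mem V x → Mem W x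
    ; _∨_     = λ V W → mkUpSet (λ x → Mem V x ⊎ Mem W x)
                                (λ x≤y → Sum.map (closed V x≤y) (closed W x≤y))
    ; _∧_     = λ V W → mkUpSet (λ x → Mem V x × Mem W x)
                                (λ x≤y → Prod.map (closed V x≤y) (closed W x≤y))
    ; _⇨_     = λ V W → mkUpSet (λ x → ∀ y → x ≤ y → Mem V y → Mem W y)
                                (λ x≤x′ f y x′≤y → f y (Poset.trans P x≤x′ x′≤y))
    ; ⊤       = mkUpSet (λ _ → ⊤) _
    ; ⊥       = mkUpSet (λ _ → ⊥) (λ _ ())
    ; isHeytingAlgebra = record
      { isBoundedLattice = record
        { isLattice = record
          { isPartialOrder = record
            { isPreorder = record
              { isEquivalence = record
                { refl  = (λ _ → id) , (λ _ → id)
                ; sym   = swap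
                ; trans = λ (f , f′) (g , g′) → (λ x → g x ∘ f x) , (λ x → f′ x ∘ g′ x)
                }
              ; reflexive = proj₁
              ; trans     = λ f g x → g x ∘ f x
              }
            ; antisym = _,_
            }
          ; supremum = λ V W → (λ _ → inj₁) , (λ _ → inj₂) , λ _ f g x → [ f x , g x ]
          ; infimum  = λ V W → (λ _ → proj₁) , (λ _ → proj₂) , λ _ f g x z → f x z , g x z
          }
        ; maximum = λ _ _ _ → tt
        ; minimum = λ _ _ ()
        }
      ; exponential = λ V W Z →
          (λ f x v y x≤y w → f y (closed V x≤y v , w)) ,
          (λ f x (v , w) → f x v x refl′ w)
      }
    } where refl′ = Poset.refl P

infix  8 p_
infixr 7 _∧_
infixr 6 _∨_
infixr 5 _⇒_
infix  3 _⊢_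

-- Intuitionistic propositional calculus, by natural deduction; ⊤ is ⊥̇ ⇒ ⊥̇.
data Form (n : ℕ) : Set where
  p_          : Fin n → Form n
  ⊥̇           : Form n
  _∧_ _∨_ _⇒_ : Form n → Form n → Form n

private variable
  n : ℕ
  Γ Δ : List (Form n)
  φ ψ χ : Form n

data _⊢_ {n : ℕ} : List (Form n) → Form n → Set where
  ax  : φ ∈ Γ → Γ ⊢ φ
  ⊥E  : Γ ⊢ ⊥̇ → Γ ⊢ φ
  ∧I  : Γ ⊢ φ → Γ ⊢ ψ → Γ ⊢ φ ∧ ψ
  ∧E₁ : Γ ⊢ φ ∧ ψ → Γ ⊢ φ
  ∧E₂ : Γ ⊢ φ ∧ ψ → Γ ⊢ ψ
  ∨I₁ : Γ ⊢ φ → Γ ⊢ φ ∨ ψ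
  ∨I₂ : Γ ⊢ ψ → Γ ⊢ φ ∨ ψ
  ∨E  : Γ ⊢ φ ∨ ψ → φ ∷ Γ ⊢ χ → ψ ∷ Γ ⊢ χ → Γ ⊢ χ
  ⇒I  : φ ∷ Γ ⊢ ψ → Γ ⊢ φ ⇒ ψ
  ⇒E  : Γ ⊢ φ ⇒ ψ → Γ ⊢ φ → Γ ⊢ ψ

private
  extend : (∀ {θ} → θ ∈ Γ → θ ∈ Δ) → ∀ {θ} → θ ∈ φ ∷ Γ → θ ∈ φ ∷ Δ
  extend ρ (here eq) = here eq
  extend ρ (there i) = there (ρ i)

weaken : (∀ {θ} → θ ∈ Γ → θ ∈ Δ) → Γ ⊢ φ → Δ ⊢ φ
weaken ρ (ax i)       = ax (ρ i)
weaken ρ (⊥E d)       = ⊥E (weaken ρ d)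
weaken ρ (∧I d e)     = ∧I (weaken ρ d) (weaken ρ e)
weaken ρ (∧E₁ d)      = ∧E₁ (weaken ρ d)
weaken ρ (∧E₂ d)      = ∧E₂ (weaken ρ d)
weaken ρ (∨I₁ d)      = ∨I₁ (weaken ρ d)
weaken ρ (∨I₂ d)      = ∨I₂ (weaken ρ d)
weaken ρ (∨E d e₁ e₂) = ∨E (weaken ρ d) (weaken (extend ρ) e₁) (weaken (extend ρ) e₂)
weaken ρ (⇒I d)       = ⇒I (weaken (extend ρ) d)
weaken ρ (⇒E d e)     = ⇒E (weaken ρ d) (weaken ρ e)

cut : Γ ⊢ φ → φ ∷ [] ⊢ ψ → Γ ⊢ ψ
cut d e = ⇒E (weaken (λ ()) (⇒I e)) d

private
  hyp : φ ∷ Γ ⊢ φ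
  hyp = ax (here refl)

FreeHeyting : ℕ → HeytingAlgebra 0ℓ 0ℓ 0ℓ
FreeHeyting n = record
  { Carrier = Form n
  ; _≈_     = λ φ ψ → (φ ∷ [] ⊢ ψ) × (ψ ∷ [] ⊢ φ)
  ; _≤_     = λ φ ψ → φ ∷ [] ⊢ ψ
  ; _∨_     = _∨_
  ; _∧_     = _∧_
  ; _⇨_     = _⇒_
  ; ⊤       = ⊥̇ ⇒ ⊥̇
  ; ⊥       = ⊥̇
  ; isHeytingAlgebra = record
    { isBoundedLattice = record
      { isLattice = record
        { isPartialOrder = record
          { isPreorder = record
            { isEquivalence = record
              { refl  = hyp , hyp
              ; sym   = swap
              ; trans = λ (d , d′) (e , e′) → cut d e , cut e′ d′
              }
            ; reflexive = proj₁
            ; trans     = cut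
            }
          ; antisym = _,_
          }
        ; supremum = λ φ ψ → ∨I₁ hyp , ∨I₂ hyp , λ χ d e →
            ∨E hyp (cut hyp d) (cut hyp e)
        ; infimum  = λ φ ψ → ∧E₁ hyp , ∧E₂ hyp , λ χ → ∧I
        }
      ; maximum = λ φ → ⇒I hyp
      ; minimum = λ φ → ⊥E hyp
      }
    ; exponential = λ φ ψ χ →
        (λ d → ⇒I (cut (∧I (ax (there (here refl))) hyp) d)) ,
        (λ d → ⇒E (cut (∧E₁ hyp) d) (∧E₂ hyp))
    }
  }

module _ (H : HeytingAlgebra c ℓ₁ ℓ₂) {n : ℕ} (v : Fin n → HeytingAlgebra.Carrier H) where
  private module H = HeytingAlgebra H

  eval : Form n → H.Carrier
  eval (p i)   = v i
  eval ⊥̇       = H.⊥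
  eval (φ ∧ ψ) = eval φ H.∧ eval ψ
  eval (φ ∨ ψ) = eval φ H.∨ eval ψ
  eval (φ ⇒ ψ) = eval φ H.⇨ eval ψ

  evalCtx : List (Form n) → H.Carrier
  evalCtx []      = H.⊤
  evalCtx (φ ∷ Γ) = evalCtx Γ H.∧ eval φ

  private
    lookup : φ ∈ Γ → evalCtx Γ H.≤ eval φ
    lookup (here refl) = H.x∧y≤y _ _
    lookup (there i)   = H.trans (H.x∧y≤x _ _) (lookup i)

  sound : Γ ⊢ φ → evalCtx Γ H.≤ eval φ
  sound (ax i)       = lookup i
  sound (⊥E d)       = H.trans (sound d) (H.minimum _)
  sound (∧I d e)     = H.∧-greatest (sound d) (sound e)
  sound (∧E₁ d)      = H.trans (sound d) (H.x∧y≤x _ _)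
  sound (∧E₂ d)      = H.trans (sound d) (H.x∧y≤y _ _)
  sound (∨I₁ d)      = H.trans (sound d) (H.x≤x∨y _ _)
  sound (∨I₂ d)      = H.trans (sound d) (H.y≤x∨y _ _)
  sound (∨E d e₁ e₂) =
    H.trans (H.∧-greatest (sound d) H.refl)
            (H.transpose-∧ (H.∨-least (case e₁) (case e₂)))
    where
    case : φ ∷ Γ ⊢ χ → eval φ H.≤ evalCtx Γ H.⇨ eval χ
    case e = H.transpose-⇨ (H.trans (H.∧-greatest (H.x∧y≤y _ _) (H.x∧y≤x _ _)) (sound e))
  sound (⇒I d)       = H.transpose-⇨ (sound d)
  sound (⇒E d e)     =
    H.trans (H.∧-greatest (sound d) (sound e)) (H.transpose-∧ H.refl)

data Term (n : ℕ) : Set where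
  p_      : Fin n → Term n
  _∧_ _⇒_ : Term n → Term n → Term n

⌜_⌝ : Term n → Form n
⌜ p i ⌝   = p i
⌜ s ∧ t ⌝ = ⌜ s ⌝ ∧ ⌜ t ⌝
⌜ s ⇒ t ⌝ = ⌜ s ⌝ ⇒ ⌜ t ⌝

-- (∧,→)-formulas modulo IPC-equivalence; freeness is established below
-- (free-ext, free-ext-p, free-ext-unique).
FreeIMS : ℕ → ImplicativeMeetSemilattice 0ℓ 0ℓ 0ℓ
FreeIMS n = record
  { Carrier           = Term n
  ; _≈_               = λ s t → ⌜ s ⌝ H.≈ ⌜ t ⌝
  ; _≤_               = λ s t → ⌜ s ⌝ H.≤ ⌜ t ⌝
  ; _∧_               = _∧_
  ; _⇨_               = _⇒_
  ; isMeetSemilattice = record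
    { isPartialOrder = On.isPartialOrder ⌜_⌝ H.isPartialOrder
    ; infimum        = λ s t → let l , r , g = H.infimum ⌜ s ⌝ ⌜ t ⌝ in l , r , g ∘ ⌜_⌝
    }
  ; exponential       = λ s t u → H.exponential ⌜ s ⌝ ⌜ t ⌝ ⌜ u ⌝
  } where module H = HeytingAlgebra (FreeHeyting n)

module _ (A : ImplicativeMeetSemilattice c ℓ₁ ℓ₂) {n : ℕ}
         (v : Fin n → ImplicativeMeetSemilattice.Carrier A) where
  private
    module A = ImplicativeMeetSemilattice A
    module F = ImplicativeMeetSemilattice (FreeIMS n)

  evalTerm : Term n → A.Carrier
  evalTerm (p i)   = v i
  evalTerm (s ∧ t) = evalTerm s A.∧ evalTerm t
  evalTerm (s ⇒ t) = evalTerm s A.⇨ evalTerm t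

  -- x ↦ ↓x preserves ∧ and → and reflects the order as a map from A to the
  -- Heyting algebra of down-sets of A, so every IPC-derivable inequality
  -- between (∧,→)-formulas holds in A.
  private
    Down : HeytingAlgebra _ _ _
    Down = UpSets (PosetProperties.≥-poset A.poset)

    module D = HeytingAlgebra Down

    ↓_ : A.Carrier → D.Carrier
    ↓ x = mkUpSet (λ y → Lift c (y A.≤ x)) (λ z≤y (lift y≤x) → lift (A.trans z≤y y≤x))

    open UpSet

    ↓-eval : ∀ t → D._≈_ (eval Down (↓_ ∘ v) ⌜ t ⌝) (↓ evalTerm t)
    ↓-eval (p i)   = (λ _ → id) , (λ _ → id)
    ↓-eval (s ∧ t) with ↓-eval s | ↓-eval t
    ... | s→ , s← | t→ , t← =
      (λ x (xs , xt) → lift (A.∧-greatest (lower (s→ x xs)) (lower (t→ x xt)))) ,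
      (λ x (lift le) → s← x (lift (A.trans le (A.x∧y≤x _ _))) ,
                       t← x (lift (A.trans le (A.x∧y≤y _ _))))
    ↓-eval (s ⇒ t) with ↓-eval s | ↓-eval t
    ... | s→ , s← | t→ , t← =
      (λ x f → lift (proj₁ (A.exponential _ _ _)
        (lower (t→ _ (f _ (A.x∧y≤x _ _) (s← _ (lift (A.x∧y≤y _ _)))))))) ,
      (λ x (lift le) y y≤x ys → t← y (lift
        (A.trans (A.∧-greatest y≤x (lower (s→ y ys))) (proj₂ (A.exponential _ _ _) le))))

  evalTerm-mono : ∀ {s t} → s F.≤ t → evalTerm s A.≤ evalTerm t
  evalTerm-mono {s} {t} d = lower
    (proj₁ (↓-eval t) _
      (sound Down (↓_ ∘ v) d _
        (tt , proj₂ (↓-eval s) _ (lift A.refl))))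

  free-ext : Homomorphism (FreeIMS n) A
  free-ext = record
    { ⟦_⟧    = evalTerm
    ; cong   = λ {s} {t} (d , e) →
                 A.antisym (evalTerm-mono {s} {t} d) (evalTerm-mono {t} {s} e)
    ; ∧-homo = λ _ _ → A.Eq.refl
    ; ⇨-homo = λ _ _ → A.Eq.refl
    }

  free-ext-p : ∀ i → Homomorphism.⟦ free-ext ⟧ (p i) A.≈ v i
  free-ext-p i = A.Eq.refl

  free-ext-unique : (h : Homomorphism (FreeIMS n) A) →
                    (∀ i → Homomorphism.⟦ h ⟧ (p i) A.≈ v i) →
                    ∀ t → Homomorphism.⟦ h ⟧ t A.≈ Homomorphism.⟦ free-ext ⟧ t
  free-ext-unique h hp = go
    where
    module h = Homomorphism h

    ∧-mono : ∀ {x x′ y y′} → x A.≤ x′ → y A.≤ y′ → x A.∧ y A.≤ x′ A.∧ y′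
    ∧-mono l r = A.∧-greatest (A.trans (A.x∧y≤x _ _) l) (A.trans (A.x∧y≤y _ _) r)

    ⇨-mono : ∀ {x x′ y y′} → x′ A.≤ x → y A.≤ y′ → x A.⇨ y A.≤ x′ A.⇨ y′
    ⇨-mono l r = proj₁ (A.exponential _ _ _)
      (A.trans (∧-mono A.refl l)
        (A.trans (proj₂ (A.exponential _ _ _) A.refl) r))

    ≤→ : ∀ {x y} → x A.≈ y → x A.≤ y
    ≤→ = A.reflexive

    ≤← : ∀ {x y} → x A.≈ y → y A.≤ x
    ≤← = A.reflexive ∘ A.Eq.sym

    go : ∀ t → h.⟦ t ⟧ A.≈ evalTerm t
    go (p i)   = hp i
    go (s ∧ t) = A.Eq.trans (h.∧-homo s t)
      (A.antisym (∧-mono (≤→ (go s)) (≤→ (go t))) (∧-mono (≤← (go s)) (≤← (go t))))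
    go (s ⇒ t) = A.Eq.trans (h.⇨-homo s t)
      (A.antisym (⇨-mono (≤← (go s)) (≤→ (go t))) (⇨-mono (≤→ (go s)) (≤← (go t))))

record Model (n : ℕ) : Set₁ where
  field
    poset : Poset 0ℓ 0ℓ 0ℓ
  open Poset poset public
  field
    colour      : Carrier → Fin n → Bool
    colour-mono : ∀ {x y} → x ≤ y → ∀ i → colour x i Bool.≤ colour y i

  infix 4 _⊨p_
  _⊨p_ : Carrier → Fin n → Set
  x ⊨p i = colour x i ≡ true

  open PosetProperties poset public using (_<_)

  Separated : Pred Carrier 0ℓ
  Separated x = ∃[ i ] (¬ x ⊨p i) × (∀ y → x < y → y ⊨p i)

-- P is not required to be an up-set: the points not satisfying P are
-- deleted and the order and colouring restricted.
_↾_ : (M : Model n) → Pred (Model.Carrier M) 0ℓ → Model n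
M ↾ P = record
  { poset       = On.poset M.poset (proj₁ {B = P})
  ; colour      = M.colour ∘ proj₁
  ; colour-mono = M.colour-mono
  } where module M = Model M

_ˢ : Model n → Model n
M ˢ = M ↾ Model.Separated M

record PMorphism (M N : Model n) : Set where
  private
    module M = Model M
    module N = Model N
  field
    homomorphism : PosetHomomorphism M.poset N.poset
  open PosetHomomorphism homomorphism public
  field
    colour-pres : ∀ x i → N.colour ⟦ x ⟧ i ≡ M.colour x i
    back        : ∀ x y → ⟦ x ⟧ N.≤ y → ∃[ x′ ] x M.≤ x′ × ⟦ x′ ⟧ N.≈ y

_≗ᵖ_ : {M N : Model n} → PMorphism M N → PMorphism M N → Set
_≗ᵖ_ {N = N} f g = ∀ x → PMorphism.⟦ f ⟧ x ≈ PMorphism.⟦ g ⟧ x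
  where open Model N using (_≈_)

Image : {M N : Model n} → PMorphism M N → Model n
Image {N = N} f = N ↾ λ y → ∃[ x ] PMorphism.⟦ f ⟧ x ≈ y
  where open Model N using (_≈_)

V : (M : Model n) → Fin n → UpSet (Model.poset M)
V M i = mkUpSet (_⊨p i) (λ x≤y → mono (colour-mono x≤y i))
  where
  open Model M
  mono : ∀ {a b} → a Bool.≤ b → a ≡ true → b ≡ true
  mono Bool.b≤b eq = eq

-- Subsets are given by characteristic functions, so that the colouring of
-- the canonical model takes values in {0,1}.  Under excluded middle every
-- predicate has a characteristic function.
record PrimeFilter (H : HeytingAlgebra c ℓ₁ ℓ₂) : Set (c ⊔ ℓ₂) where
  private module H = HeytingAlgebra H
  field
    member : H.Carrier → Bool

  Mem : Pred H.Carrier 0ℓ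
  Mem a = member a ≡ true

  field
    upward   : ∀ {a b} → a H.≤ b → Mem a → Mem b
    ∧-closed : ∀ {a b} → Mem a → Mem b → Mem (a H.∧ b)
    ⊤-mem    : Mem H.⊤
    ⊥-nonmem : ¬ Mem H.⊥
    prime    : ∀ {a b} → Mem (a H.∨ b) → Mem a ⊎ Mem b

Canonical : (n : ℕ) → Model n
Canonical n = record
  { poset = record
    { Carrier = PrimeFilter (FreeHeyting n)
    ; _≈_     = λ x y → (∀ φ → Mem x φ → Mem y φ) × (∀ φ → Mem y φ → Mem x φ)
    ; _≤_     = λ x y → ∀ φ → Mem x φ → Mem y φ
    ; isPartialOrder = record
      { isPreorder = record
        { isEquivalence = record
          { refl  = (λ _ → id) , (λ _ → id)
          ; sym   = swap
          ; trans = λ (f , f′) (g , g′) → (λ φ → g φ ∘ f φ) , (λ φ → f′ φ ∘ g′ φ)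
          }
        ; reflexive = proj₁
        ; trans     = λ f g φ → g φ ∘ f φ
        }
      ; antisym = _,_
      }
    }
  ; colour      = λ x i → member x (p i)
  ; colour-mono = λ x⊆y i → ≤-intro (x⊆y (p i))
  }
  where
  open PrimeFilter
  ≤-intro : ∀ {a b} → (a ≡ true → b ≡ true) → a Bool.≤ b
  ≤-intro {false} {false} _ = Bool.b≤b
  ≤-intro {false} {true}  _ = Bool.f≤t
  ≤-intro {true}  {b}     f with f refl
  ... | refl = Bool.b≤b

FiniteUp : (M : Model n) → Pred (Model.Carrier M) 0ℓ
FiniteUp M x = Finite (On.setoid (record { isEquivalence = isEquivalence }) (proj₁ {B = x ≤_}))
  where open Model M

U : (n : ℕ) → Model n
U n = Canonical n ↾ FiniteUp (Canonical n)

-- The only homomorphism with pᵢ ↦ {x ∈ M ∣ x ⊨ pᵢ}, by free-ext-unique.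
h : (M : Model n) → Homomorphism (FreeIMS n) (∧⇨-reduct (UpSets (Model.poset M)))
h M = free-ext (∧⇨-reduct (UpSets (Model.poset M))) (V M)

{-# OPTIONS --safe #-}
module Submission where

-- Lindenbaum's lemma in the form used here extends a theory omitting ψ to a
-- prime filter y omitting ψ that contains, for each θ, either θ or θ ⇒ ψ; so
-- every prime filter strictly above y contains ψ.  With ψ a variable, y is
-- separated, and hence every point refuting p lies below a separated point
-- refuting p.  By induction on t, a (∧,→)-term t is then forced at x iff it is
-- forced, in Mˢ, at all separated points above x.
--
-- In Mˢ the colour increases strictly along the order, so by induction on the
-- number of missing colours there are only finitely many theories of points,
-- hence only finitely many formulas up to equivalence in Mˢ.  Therefore
-- x ↦ Th(x) is a p-morphism from Mˢ into U(n).  If s ⊬ t, then s ⇒ t fails in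
-- the canonical model C, hence in Cˢ, hence in U(n) as the image of Cˢ, hence
-- in U(n)ˢ, and hence in the image of U(n)ˢ.

open import Defs
open import Level using (Level; 0ℓ)
open import Axiom.ExcludedMiddle using (ExcludedMiddle)
open import Data.Bool.Base using (Bool; true; false)
open import Data.Fin.Base using (Fin)
open import Data.Fin.Subset using (Subset; ∣_∣)
open import Data.Fin.Subset.Properties using (∣p∣≤n; p⊂q⇒∣p∣<∣q∣)
open import Data.List.Base using (List; []; _∷_; _++_; map; allFin; cartesianProductWith)
open import Data.List.Membership.Propositional using (_∈_; find)
open import Data.List.Membership.Propositional.Properties
  using (∈-++⁺ˡ; ∈-++⁺ʳ; ∈-map⁺; ∈-allFin; ∈-cartesianProductWith⁺)
open import Data.List.Relation.Unary.All as All using (All; []; _∷_)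
open import Data.List.Relation.Unary.Any as Any using (Any; here; there)
import Data.List.Relation.Unary.Any.Properties as Any
open import Data.Nat.Base as ℕ using (ℕ; zero; suc; _+_; _⊔_; _≤′_; ≤′-refl; ≤′-step; s≤s)
import Data.Nat.Properties as ℕ
open import Data.Product.Base using (Σ-syntax; ∃; ∃-syntax; _×_; _,_; proj₁; proj₂)
open import Data.Product.Function.NonDependent.Propositional using (_×-⇔_)
open import Data.Sum.Base as Sum using (_⊎_; inj₁; inj₂; [_,_]′)
open import Data.Sum.Function.Propositional using (_⊎-⇔_)
open import Data.Unit.Base using (⊤; tt)
open import Data.Vec.Base using (tabulate)
open import Data.Vec.Properties using ([]=⇒lookup; lookup⇒[]=; lookup∘tabulate)
open import Function.Base using (_∘_; id; flip)
open import Function.Bundles using (_⇔_; mk⇔; module Equivalence)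
open import Function.Construct.Composition using (_⇔-∘_)
open import Function.Construct.Identity using (⇔-id)
open import Function.Construct.Symmetry using (⇔-sym)
open import Function.Definitions using (Injective)
open import Relation.Binary.Bundles using (Setoid; Poset)
open import Relation.Binary.Lattice using (HeytingAlgebra)
import Relation.Binary.Lattice.Properties.MeetSemilattice as MeetSemilatticeProperties
open import Relation.Binary.Morphism.Bundles using (mkPosetHomo)
import Relation.Binary.Construct.On as On
open import Relation.Binary.PropositionalEquality using (_≡_; refl; sym; trans; cong₂; subst)
open import Relation.Nullary.Decidable using (yes; no; does; decidable-stable; toSum)
open import Relation.Nullary.Negation using (¬_; contradiction)
open import Relation.Unary using (Pred)

open Equivalence using (to; from)

private variable
  n : ℕ
  Γ : List (Form n)
  φ ψ χ : Form n

-- Formulas of bounded depth.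

depth : Form n → ℕ
depth (p i)   = 1
depth ⊥̇       = 1
depth (φ ∧ ψ) = suc (depth φ ⊔ depth ψ)
depth (φ ∨ ψ) = suc (depth φ ⊔ depth ψ)
depth (φ ⇒ ψ) = suc (depth φ ⊔ depth ψ)

-- Stands in for an enumeration of all formulas: the Lindenbaum construction decides one of these
-- finite lists per stage, and `∈-formulas` puts every formula into some list.
formulas : ℕ → List (Form n)
formulas zero    = []
formulas (suc k) =
  ⊥̇ ∷ map p_ (allFin _) ++ combine _∧_ ++ combine _∨_ ++ combine _⇒_
  where
  combine : (Form _ → Form _ → Form _) → List (Form _)
  combine _⊙_ = cartesianProductWith _⊙_ (formulas k) (formulas k)

∈-formulas : ∀ (φ : Form n) {k} → depth φ ℕ.≤ k → φ ∈ formulas k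
∈-formulas (p i)   (s≤s _) = there (∈-++⁺ˡ (∈-map⁺ p_ (∈-allFin i)))
∈-formulas ⊥̇       (s≤s _) = here refl
∈-formulas (φ ∧ ψ) (s≤s l) =
  there (∈-++⁺ʳ (map p_ (allFin _)) (∈-++⁺ˡ
    (∈-cartesianProductWith⁺ _∧_ (∈-formulas φ (ℕ.m⊔n≤o⇒m≤o _ _ l))
                                 (∈-formulas ψ (ℕ.m⊔n≤o⇒n≤o _ _ l)))))
∈-formulas (φ ∨ ψ) {suc k} (s≤s l) =
  there (∈-++⁺ʳ (map p_ (allFin _)) (∈-++⁺ʳ (cartesianProductWith _∧_ (formulas k) (formulas k))
    (∈-++⁺ˡ
      (∈-cartesianProductWith⁺ _∨_ (∈-formulas φ (ℕ.m⊔n≤o⇒m≤o _ _ l))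
                                   (∈-formulas ψ (ℕ.m⊔n≤o⇒n≤o _ _ l))))))
∈-formulas (φ ⇒ ψ) {suc k} (s≤s l) =
  there (∈-++⁺ʳ (map p_ (allFin _)) (∈-++⁺ʳ (cartesianProductWith _∧_ (formulas k) (formulas k))
    (∈-++⁺ʳ (cartesianProductWith _∨_ (formulas k) (formulas k))
      (∈-cartesianProductWith⁺ _⇒_ (∈-formulas φ (ℕ.m⊔n≤o⇒m≤o _ _ l))
                                   (∈-formulas ψ (ℕ.m⊔n≤o⇒n≤o _ _ l))))))

hyp₀ : φ ∷ Γ ⊢ φ
hyp₀ = ax (here refl)

hyp₁ : φ ∷ ψ ∷ Γ ⊢ ψ
hyp₁ = ax (there (here refl))

hyp₂ : φ ∷ ψ ∷ χ ∷ Γ ⊢ χ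
hyp₂ = ax (there (there (here refl)))

-- Theories and prime filters.

record Theory (n : ℕ) : Set₁ where
  field
    Mem     : Pred (Form n) 0ℓ
    theorem : [] ⊢ φ → Mem φ
    mp      : Mem (φ ⇒ ψ) → Mem φ → Mem ψ

  deduce : All Mem Γ → Γ ⊢ φ → Mem φ
  deduce []       d = theorem d
  deduce (m ∷ ms) d = mp (deduce ms (⇒I d)) m

  deduce₁ : φ ∷ [] ⊢ ψ → Mem φ → Mem ψ
  deduce₁ d m = deduce (m ∷ []) d

open Theory

-- The theory generated by `T` and `χ`, in the form given by the deduction theorem.
_▹_ : Theory n → Form n → Theory n
T ▹ χ = record
  { Mem     = λ θ → Mem T (χ ⇒ θ)
  ; theorem = λ d → theorem T (⇒I (weaken (λ ()) d))
  ; mp      = λ a b → deduce T (a ∷ b ∷ [])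
      (⇒I (⇒E (⇒E hyp₁ hyp₀) (⇒E hyp₂ hyp₀)))
  }

consequences : Form n → Theory n
consequences χ = record
  { Mem     = χ ∷ [] ⊢_
  ; theorem = weaken λ ()
  ; mp      = ⇒E
  }

Prime : ℕ → Set
Prime n = PrimeFilter (FreeHeyting n)

filterTheory : Prime n → Theory n
filterTheory y = record
  { Mem     = PrimeFilter.Mem y
  ; theorem = λ d → upward (weaken (λ ()) d) ⊤-mem
  ; mp      = λ a b → upward (⇒E (∧E₁ hyp₀) (∧E₂ hyp₀)) (∧-closed a b)
  }
  where open PrimeFilter y

infix 4 _∋_
_∋_ : Prime n → Form n → Set
y ∋ φ = PrimeFilter.Mem y φ

-- Forcing, p-morphisms and the map `h`.

infix 4 forces
forces : (M : Model n) → Model.Carrier M → Form n → Set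
forces M x φ = UpSet.Mem (eval (UpSets (Model.poset M)) (V M) φ) x
syntax forces M x φ = x ⊩[ M ] φ

module _ (M : Model n) where
  open Model M

  persistent : ∀ φ {x y} → x ≤ y → x ⊩[ M ] φ → y ⊩[ M ] φ
  persistent φ = UpSet.closed (eval (UpSets poset) (V M) φ)

  theoryOf : Carrier → Theory n
  theoryOf x = record
    { Mem     = forces M x
    ; theorem = λ d → sound (UpSets poset) (V M) d x _
    ; mp      = λ f m → f x (Poset.refl poset) m
    }

  SameTheory : Carrier → Carrier → Set
  SameTheory x y = ∀ φ → x ⊩[ M ] φ ⇔ y ⊩[ M ] φ

  ColourIncreasing : Set
  ColourIncreasing = ∀ x y → x ≤ y → ¬ y ≤ x → ∃[ i ] (¬ x ⊨p i) × y ⊨p i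

  upsetSetoid : Carrier → Setoid 0ℓ 0ℓ
  upsetSetoid x = On.setoid (Poset.Eq.setoid poset) (proj₁ {B = x ≤_})

  UpClosed : Pred Carrier 0ℓ → Set
  UpClosed Q = ∀ x y → x ≤ y → Q x → Q y

pmorphism-preserves : ∀ {M N : Model n} (f : PMorphism M N) φ x →
                      x ⊩[ M ] φ ⇔ PMorphism.⟦ f ⟧ x ⊩[ N ] φ
pmorphism-preserves {M = M} {N} f = go
  where
  open PMorphism f
  module N = Model N
  go : ∀ φ x → x ⊩[ M ] φ ⇔ ⟦ x ⟧ ⊩[ N ] φ
  go (p i)   x = mk⇔ (trans (colour-pres x i)) (trans (sym (colour-pres x i)))
  go ⊥̇       x = mk⇔ (λ ()) (λ ())
  go (φ ∧ ψ) x = go φ x ×-⇔ go ψ x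
  go (φ ∨ ψ) x = go φ x ⊎-⇔ go ψ x
  go (φ ⇒ ψ) x = mk⇔
    (λ g y fx≤y yφ → let x′ , x≤x′ , eq = back x y fx≤y in
      persistent N ψ (N.reflexive eq) (to (go ψ x′) (g x′ x≤x′
        (from (go φ x′) (persistent N φ (N.reflexive (N.Eq.sym eq)) yφ)))))
    (λ g y x≤y yφ → from (go ψ y) (g ⟦ y ⟧ (mono x≤y) (to (go φ y) yφ)))

corestrict : ∀ {M N : Model n} (f : PMorphism M N) → PMorphism M (Image f)
corestrict {M = M} {N} f = record
  { homomorphism = mkPosetHomo _ _ (λ x → ⟦ x ⟧ , x , N.Eq.refl) mono
  ; colour-pres  = colour-pres
  ; back         = λ x (y , _) → back x y
  }
  where
  open PMorphism f
  module N = Model N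

-- Links `h`, which evaluates terms in the reduct, to forcing, which evaluates formulas in the
-- Heyting algebra.
evalTerm≡eval : ∀ {c ℓ₁ ℓ₂} (H : HeytingAlgebra c ℓ₁ ℓ₂) (v : Fin n → HeytingAlgebra.Carrier H) t →
                evalTerm (∧⇨-reduct H) v t ≡ eval H v ⌜ t ⌝
evalTerm≡eval H v (p i)   = refl
evalTerm≡eval H v (s ∧ t) = cong₂ (HeytingAlgebra._∧_ H) (evalTerm≡eval H v s) (evalTerm≡eval H v t)
evalTerm≡eval H v (s ⇒ t) = cong₂ (HeytingAlgebra._⇨_ H) (evalTerm≡eval H v s) (evalTerm≡eval H v t)

h⇔forces : (M : Model n) (t : Term n) (x : Model.Carrier M) →
           UpSet.Mem (Homomorphism.⟦_⟧ (h M) t) x ⇔ x ⊩[ M ] ⌜ t ⌝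
h⇔forces M t x = subst (λ W → UpSet.Mem (Homomorphism.⟦_⟧ (h M) t) x ⇔ UpSet.Mem W x)
                       (evalTerm≡eval (UpSets (Model.poset M)) (V M) t) (⇔-id _)

-- Counting colours.

colours : (M : Model n) → Model.Carrier M → Subset n
colours M x = tabulate (Model.colour M x)

module _ (M : Model n) (inc : ColourIncreasing M) where
  open Model M using (_⊨p_) renaming (_≤_ to _⊑_)

  -- Supplies the measure for the induction in `theories-below`: each strict step up gains a colour,
  -- and at most `n` are available.
  colours-< : ∀ {x y} → x ⊑ y → ¬ y ⊑ x → ∣ colours M x ∣ ℕ.< ∣ colours M y ∣
  colours-< {x} {y} x⊑y y⋢x = let i , x⊭i , y⊨i = inc x y x⊑y y⋢x in
    p⊂q⇒∣p∣<∣q∣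
      ( (λ {j} m → coloured⁺ y j (UpSet.closed (V M j) x⊑y (coloured⁻ x j m)))
      , i , coloured⁺ y i y⊨i , λ m → x⊭i (coloured⁻ x i m))
    where
    open import Data.Fin.Subset using () renaming (_∈_ to _∈ₛ_)
    coloured⁺ : ∀ x i → x ⊨p i → i ∈ₛ colours M x
    coloured⁺ x i e = lookup⇒[]= i _ (trans (lookup∘tabulate _ i) e)
    coloured⁻ : ∀ x i → i ∈ₛ colours M x → x ⊨p i
    coloured⁻ x i m = trans (sym (lookup∘tabulate _ i)) ([]=⇒lookup m)

module _ (em : ExcludedMiddle 0ℓ) where

  by-contradiction : {P : Set} → ¬ ¬ P → P
  by-contradiction = decidable-stable em

  -- Finiteness from finitely many predicates.

  Agree : {X I : Set} → (I → Pred X 0ℓ) → List I → X → X → Set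
  Agree P is x y = All (λ i → P i x ⇔ P i y) is

  -- Each predicate in `is` cuts `Q` in two, and excluded middle picks a point from every nonempty
  -- cell. The counting of theories, formulas and up-sets below rests on this.
  representatives : {X I : Set} (P : I → Pred X 0ℓ) (is : List I) (Q : Pred X 0ℓ) →
                    ∃[ xs ] (∀ x → Q x → Any (λ y → Q y × Agree P is x y) xs)
  representatives P [] Q with em {∃ Q}
  ... | yes (y , q) = y ∷ [] , λ _ _ → here (q , [])
  ... | no ∄Q       = [] , λ x q → contradiction (x , q) ∄Q
  representatives P (i ∷ is) Q
    with representatives P is (λ x → Q x × P i x)
       | representatives P is (λ x → Q x × ¬ P i x)
  ... | xs , cover | xs′ , cover′ = xs ++ xs′ , λ x q → [ inside x q , outside x q ]′ (toSum em)
    where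
    inside : ∀ x → Q x → P i x → Any (λ y → Q y × Agree P (i ∷ is) x y) (xs ++ xs′)
    inside x q m = Any.++⁺ˡ (Any.map
      (λ ((q′ , m′) , as) → q′ , mk⇔ (λ _ → m′) (λ _ → m) ∷ as) (cover x (q , m)))
    outside : ∀ x → Q x → ¬ P i x → Any (λ y → Q y × Agree P (i ∷ is) x y) (xs ++ xs′)
    outside x q ¬m = Any.++⁺ʳ xs (Any.map
      (λ ((q′ , ¬m′) , as) → q′ , mk⇔ (flip contradiction ¬m) (flip contradiction ¬m′) ∷ as)
      (cover′ x (q , ¬m)))

  finite-of-agree : (S : Setoid 0ℓ 0ℓ) {I : Set} (P : I → Pred (Setoid.Carrier S) 0ℓ) (is : List I) →
                    (∀ {x y} → Agree P is x y → Setoid._≈_ S x y) → Finite S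
  finite-of-agree S P is agree⇒≈ =
    let xs , cover = representatives P is (λ _ → ⊤) in
    xs , λ x → Any.map (agree⇒≈ ∘ proj₂) (cover x tt)

  -- Lindenbaum's lemma relative to an omitted formula.

  toPrime : (T : Theory n) → ¬ Mem T ⊥̇ → (∀ {φ ψ} → Mem T (φ ∨ ψ) → Mem T φ ⊎ Mem T ψ) →
            Σ[ y ∈ Prime n ] (∀ φ → y ∋ φ ⇔ Mem T φ)
  toPrime T ⊥∉T prime = record
    { member   = member
    ; upward   = λ d m → member⁺ (deduce₁ T d (member⁻ m))
    ; ∧-closed = λ a b → member⁺ (deduce T (member⁻ a ∷ member⁻ b ∷ []) (∧I hyp₀ hyp₁))
    ; ⊤-mem    = member⁺ (theorem T (⇒I hyp₀))
    ; ⊥-nonmem = ⊥∉T ∘ member⁻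
    ; prime    = λ m → Sum.map member⁺ member⁺ (prime (member⁻ m))
    } , λ φ → mk⇔ member⁻ member⁺
    where
    -- Membership in a `PrimeFilter` is Boolean; excluded middle turns the predicate into a
    -- characteristic function.
    member : Form _ → Bool
    member φ = does (em {Mem T φ})
    member⁺ : Mem T φ → member φ ≡ true
    member⁺ {φ} m with em {Mem T φ}
    ... | yes _ = refl
    ... | no ¬m = contradiction m ¬m
    member⁻ : member φ ≡ true → Mem T φ
    member⁻ {φ} eq with em {Mem T φ}
    ... | yes m = m

  module _ (T : Theory n) (ψ : Form n) (ψ∉T : ¬ Mem T ψ) where

    Omits : Pred (Form n) 0ℓ
    Omits χ = ¬ Mem T (χ ⇒ ψ)

    -- With `ψ` to be omitted, `θ ⇒ ψ` plays the part of the negation of `θ`.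
    Decides : Form n → Form n → Set
    Decides χ θ = Mem T (χ ⇒ θ) ⊎ Mem T (χ ⇒ θ ⇒ ψ)

    strengthen : ∀ {χ χ′ θ} → χ′ ∷ [] ⊢ χ → Mem T (χ ⇒ θ) → Mem T (χ′ ⇒ θ)
    strengthen d = deduce₁ T (⇒I (⇒E hyp₁ (weaken (λ { (here refl) → here refl }) d)))

    -- The single formula `χ` carries all additions made so far. If adding `θ` would yield `ψ`, then
    -- `χ` already gives `θ ⇒ ψ` by currying; otherwise `θ` joins the conjunction. Both outcomes
    -- survive later strengthening of `χ`.
    decideAll : ∀ θs χ → Omits χ →
                ∃[ χ′ ] (χ′ ∷ [] ⊢ χ) × Omits χ′ × All (Decides χ′) θs
    decideAll []       χ o = χ , hyp₀ , o , []
    decideAll (θ ∷ θs) χ o with em {Mem T (χ ∧ θ ⇒ ψ)}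
    ... | yes m =
      let χ′ , d , o′ , ds = decideAll θs χ o in
      χ′ , d , o′ , inj₂ (strengthen d (deduce₁ T (⇒I (⇒I (⇒E hyp₂ (∧I hyp₁ hyp₀)))) m)) ∷ ds
    ... | no ¬m =
      let χ′ , d , o′ , ds = decideAll θs (χ ∧ θ) ¬m in
      χ′ , cut d (∧E₁ hyp₀) , o′ , inj₁ (theorem T (⇒I (cut d (∧E₂ hyp₀)))) ∷ ds

    stage : ℕ → ∃ Omits
    -- `⊥̇ ⇒ ⊥̇` is a theorem, so the construction starts from `T` itself.
    stage zero    = ⊥̇ ⇒ ⊥̇ , λ m → ψ∉T (deduce₁ T (⇒E hyp₀ (⇒I hyp₀)) m)
    stage (suc k) = let χ′ , _ , o , _ = decideAll (formulas k) _ (proj₂ (stage k)) in χ′ , o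

    stage-anti : ∀ {j k} → j ≤′ k → proj₁ (stage k) ∷ [] ⊢ proj₁ (stage j)
    stage-anti ≤′-refl         = hyp₀
    stage-anti (≤′-step {k} l) =
      cut (proj₁ (proj₂ (decideAll (formulas k) _ (proj₂ (stage k))))) (stage-anti l)

    maximalTheory : Theory n
    maximalTheory = record
      { Mem     = λ θ → ∃[ k ] Mem T (proj₁ (stage k) ⇒ θ)
      ; theorem = λ d → 0 , theorem (T ▹ _) d
      ; mp      = λ (j , a) (k , b) → j ⊔ k , mp (T ▹ _)
          (strengthen (stage-anti (ℕ.≤⇒≤′ (ℕ.m≤m⊔n j k))) a)
          (strengthen (stage-anti (ℕ.≤⇒≤′ (ℕ.m≤n⊔m j k))) b)
      }

    maximal : ∀ θ → Mem maximalTheory θ ⊎ Mem maximalTheory (θ ⇒ ψ)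
    maximal θ = Sum.map (k ,_) (k ,_)
      (All.lookup (proj₂ (proj₂ (proj₂ (decideAll (formulas (depth θ)) _ (proj₂ (stage (depth θ)))))))
                  (∈-formulas θ ℕ.≤-refl))
      -- `θ` occurs in `formulas (depth θ)`, and that list is decided on passing to the next stage.
      where k = suc (depth θ)

    ψ∉maximal : ¬ Mem maximalTheory ψ
    ψ∉maximal (k , m) = proj₂ (stage k) m

    -- Otherwise `maximal` gives both implications into `ψ`, and disjunction elimination would put
    -- `ψ` into the theory.
    maximal-prime : ∀ {a b} → Mem maximalTheory (a ∨ b) →
                    Mem maximalTheory a ⊎ Mem maximalTheory b
    maximal-prime {a} {b} m with maximal a | maximal b
    ... | inj₁ a∈ | _       = inj₁ a∈
    ... | inj₂ _  | inj₁ b∈ = inj₂ b∈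
    ... | inj₂ a⇒ | inj₂ b⇒ = contradiction
      (deduce maximalTheory (m ∷ a⇒ ∷ b⇒ ∷ [])
        (∨E hyp₀ (⇒E hyp₂ hyp₀) (⇒E (ax (there (there (there (here refl))))) hyp₀)))
      ψ∉maximal

    lindenbaum : Σ[ y ∈ Prime n ] (∀ φ → Mem T φ → y ∋ φ) × (¬ y ∋ ψ) ×
                 (∀ θ → y ∋ θ ⊎ y ∋ (θ ⇒ ψ))
    lindenbaum =
      let y , y⇔ = toPrime maximalTheory
                     (ψ∉maximal ∘ deduce₁ maximalTheory (⊥E hyp₀)) maximal-prime in
      y , (λ φ m → from (y⇔ φ) (0 , deduce₁ T (⇒I hyp₁) m)) , (ψ∉maximal ∘ to (y⇔ ψ)) ,
      λ θ → Sum.map (from (y⇔ θ)) (from (y⇔ (θ ⇒ ψ))) (maximal θ)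

  -- Up-sets of the canonical model.

  module _ (Q : Pred (Prime n) 0ℓ) (Q-up : UpClosed (Canonical n) Q) where
    private
      K = Canonical n ↾ Q
      module K = Model K

    -- Serves both the whole canonical model and `U n`. For an implication missing from `x`, the
    -- Lindenbaum extension refuting it lies above `x`, so up-closure of `Q` keeps it in the
    -- submodel.
    truth : ∀ φ (x : K.Carrier) → x ⊩[ K ] φ ⇔ proj₁ x ∋ φ
    truth (p i)   x = ⇔-id _
    truth ⊥̇       x = mk⇔ (λ ()) (flip contradiction (PrimeFilter.⊥-nonmem (proj₁ x)))
    truth (φ ∧ ψ) x = mk⇔ (λ (a , b) → PrimeFilter.∧-closed (proj₁ x) a b)
                          (λ m → deduce₁ T (∧E₁ hyp₀) m , deduce₁ T (∧E₂ hyp₀) m)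
                      ⇔-∘ (truth φ x ×-⇔ truth ψ x)
      where T = filterTheory (proj₁ x)
    truth (φ ∨ ψ) x = mk⇔ [ deduce₁ T (∨I₁ hyp₀) , deduce₁ T (∨I₂ hyp₀) ]′
                          (PrimeFilter.prime (proj₁ x))
                      ⇔-∘ (truth φ x ⊎-⇔ truth ψ x)
      where T = filterTheory (proj₁ x)
    truth (φ ⇒ ψ) x = mk⇔
      (λ f → by-contradiction λ ¬m →
        let y , T▹φ⊆y , ψ∉y , _ = lindenbaum (T ▹ φ) ψ ¬m
            x⊆y = λ θ m → T▹φ⊆y θ (deduce₁ T (⇒I hyp₁) m)
            y′  = y , Q-up (proj₁ x) y x⊆y (proj₂ x)
        in ψ∉y (to (truth ψ y′) (f y′ x⊆y (from (truth φ y′) (T▹φ⊆y φ (theorem T (⇒I hyp₀)))))))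
      (λ m y x⊆y yφ → from (truth ψ y)
        (mp (filterTheory (proj₁ y)) (x⊆y _ m) (to (truth φ y) yφ)))
      where T = filterTheory (proj₁ x)

    separated-above : ∀ x i → ¬ x K.⊨p i → ∃[ y ] (x K.≤ y) × K.Separated y × (¬ y K.⊨p i)
    separated-above x i ¬xi =
      let y , x⊆y , i∉y , maximal = lindenbaum (filterTheory (proj₁ x)) (p i) ¬xi in
      (y , Q-up (proj₁ x) y x⊆y (proj₂ x)) , x⊆y ,
      -- Suppose `z` above `y` omits `p i`. No `θ` in `z` can have `θ ⇒ p i` in `y`, so each such
      -- `θ` lies in `y`, and `z` equals `y`.
      (i , i∉y , λ (z , _) (y⊆z , y≉z) → by-contradiction λ i∉z → y≉z
        (y⊆z , λ θ m → [ id , (λ θ⇒i → contradiction (mp (filterTheory z) (y⊆z _ θ⇒i) m) i∉z) ]′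
                       (maximal θ))) ,
      i∉y

  -- Reduction to separated points.

  module _ (M : Model n) where
    open Model M

    -- Conjunction and implication commute with quantifying over the separated points above `x`, and
    -- `sep` settles variables. Disjunction would break the induction, since different separated
    -- points may force different disjuncts; so would `⊥̇`, at a point with no separated point above
    -- it.
    forces-via-separated :
      (∀ x i → ¬ x ⊨p i → ∃[ y ] (x ≤ y) × Separated y × (¬ y ⊨p i)) →
      ∀ t x → x ⊩[ M ] ⌜ t ⌝ ⇔ (∀ y → x ≤ proj₁ y → y ⊩[ M ˢ ] ⌜ t ⌝)
    forces-via-separated sep = go
      where
      go : ∀ t x → x ⊩[ M ] ⌜ t ⌝ ⇔ (∀ y → x ≤ proj₁ y → y ⊩[ M ˢ ] ⌜ t ⌝)
      go (p i)   x = mk⇔ (λ m _ x≤y → persistent M (p i) x≤y m)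
        (λ f → by-contradiction λ ¬m →
          let y , x≤y , s , ¬y = sep x i ¬m in ¬y (f (y , s) x≤y))
      go (s ∧ t) x = mk⇔
        (λ (a , b) y x≤y → to (go s x) a y x≤y , to (go t x) b y x≤y)
        (λ f → from (go s x) (λ y x≤y → proj₁ (f y x≤y)) , from (go t x) (λ y x≤y → proj₂ (f y x≤y)))
      go (s ⇒ t) x = mk⇔
        (λ f y x≤y z y≤z zs → to (go t (proj₁ z))
          (f _ (M.trans x≤y y≤z)
            (from (go s _) (λ w z≤w → persistent (M ˢ) ⌜ s ⌝ {z} {w} z≤w zs)))
          z M.refl)
        (λ f z x≤z zs → from (go t z) λ w z≤w →
          f w (M.trans x≤z z≤w) w M.refl (to (go s z) zs w z≤w))
        where module M = Model M using (trans; refl)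

    -- The colour gained is the variable that separates the lower point.
    separated-increasing : ColourIncreasing (M ˢ)
    separated-increasing (_ , i , x⊭i , above) (y , _) x≤y y≰x =
      i , x⊭i , above y (x≤y , λ x≈y → y≰x (reflexive (Eq.sym x≈y)))

  -- Finitely many theories under strictly increasing colours.

  module _ (M : Model n) (inc : ColourIncreasing M) where
    private
      open module M = Model M using (Carrier; _⊨p_) renaming (_≤_ to _⊑_)

      -- Fewer than `k` of the `n` variables fail at `x`, written without truncated subtraction.
      Missing< : ℕ → Pred Carrier 0ℓ
      Missing< k x = n ℕ.< ∣ colours M x ∣ + k

      Features : Fin n ⊎ Carrier → Pred Carrier 0ℓ
      Features (inj₁ i) x = x ⊨p i
      Features (inj₂ r) x = ∃[ z ] x ⊑ z × SameTheory M z r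

      features : List Carrier → List (Fin n ⊎ Carrier)
      features rs = map inj₁ (allFin n) ++ map inj₂ rs

      -- The formulas true at x depend only on its colour and on the theories
      -- seen from x: a point above x that is not below it has fewer missing
      -- colours, so its theory is represented in rs.
      module _ {k rs} (cover : ∀ x → Missing< k x → Any (SameTheory M x) rs) where

        ⇒-transfer : ∀ {φ ψ x y} → Missing< (suc k) y →
                     x ⊩[ M ] φ ⇔ y ⊩[ M ] φ → x ⊩[ M ] ψ ⇔ y ⊩[ M ] ψ →
                     (∀ r → r ∈ rs → Features (inj₂ r) y → Features (inj₂ r) x) →
                     x ⊩[ M ] (φ ⇒ ψ) → y ⊩[ M ] (φ ⇒ ψ)
        ⇒-transfer {φ} {ψ} {x} {y} b φ⇔ ψ⇔ seen f z y⊑z zφ with em {z ⊑ y}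
        -- Here `z` and `y` force the same formulas, so the hypothesis is applied at `x` itself.
        ... | yes z⊑y = persistent M ψ y⊑z
          (to ψ⇔ (f x M.refl (from φ⇔ (persistent M φ z⊑y zφ))))
        ... | no z⋢y =
          let r , r∈ , z~r     = find (cover z missing)
              w , x⊑w , w~r    = seen r r∈ (z , y⊑z , z~r)
          in from (z~r ψ) (to (w~r ψ) (f w x⊑w (from (w~r φ) (to (z~r φ) zφ))))
          where
          missing : Missing< k z
          -- The colour gained from `y` to `z` pays for the drop from `suc k` to `k`.
          missing = ℕ.<-≤-trans b (ℕ.≤-trans (ℕ.≤-reflexive (ℕ.+-suc _ k))
                      (ℕ.+-monoˡ-≤ k (colours-< M inc y⊑z z⋢y)))

        agree⇒same : ∀ {x y} → Missing< (suc k) x → Missing< (suc k) y →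
                     Agree Features (features rs) x y → SameTheory M x y
        agree⇒same {x} {y} bx by agree = go
          where
          go : SameTheory M x y
          go (p i)   = All.lookup agree (∈-++⁺ˡ (∈-map⁺ inj₁ (∈-allFin i)))
          go ⊥̇       = mk⇔ (λ ()) (λ ())
          go (φ ∧ ψ) = go φ ×-⇔ go ψ
          go (φ ∨ ψ) = go φ ⊎-⇔ go ψ
          go (φ ⇒ ψ) = mk⇔
            (⇒-transfer {φ} {ψ} by (go φ) (go ψ) (λ r → from ∘ seen r))
            (⇒-transfer {φ} {ψ} bx (⇔-sym (go φ)) (⇔-sym (go ψ)) (λ r → to ∘ seen r))
            where
            seen : ∀ r → r ∈ rs → Features (inj₂ r) x ⇔ Features (inj₂ r) y
            seen r r∈ = All.lookup agree (∈-++⁺ʳ (map inj₁ (allFin n)) (∈-map⁺ inj₂ r∈))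

      theories-below : ∀ k → ∃[ rs ] (∀ x → Missing< k x → Any (SameTheory M x) rs)
      theories-below zero = [] , λ x b → contradiction
        (∣p∣≤n (colours M x)) (ℕ.<⇒≱ (ℕ.<-≤-trans b (ℕ.≤-reflexive (ℕ.+-identityʳ _))))
      theories-below (suc k) =
        let rs , cover   = theories-below k
            rs′ , cover′ = representatives Features (features rs) (Missing< (suc k))
        in rs′ , λ x b → Any.map (λ (b′ , agree) → agree⇒same {rs = rs} cover b b′ agree) (cover′ x b)

    finitely-many-theories : ∃[ rs ] (∀ x → Any (SameTheory M x) rs)
    finitely-many-theories =
      -- At most `n` variables can be missing, so the bound `suc n` admits every point.
      let rs , cover = theories-below (suc n) in rs , λ x → cover x (ℕ.m≤n+m (suc n) _)

    private
      rs = proj₁ finitely-many-theories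

    -- Every point has the theory of some point in `rs`, so agreement there spreads to all of `M`.
    -- The map `f` lets this cover formulas and terms alike.
    agree⇒equivalent : {A : Set} (f : A → Form n) {a b : A} →
                       Agree (λ r a → r ⊩[ M ] f a) rs a b →
                       ∀ x → x ⊩[ M ] f a ⇔ x ⊩[ M ] f b
    agree⇒equivalent f {a} {b} agree x =
      let r , r∈ , x~r = find (proj₂ finitely-many-theories x) in
      ⇔-sym (x~r (f b)) ⇔-∘ (All.lookup agree r∈ ⇔-∘ x~r (f a))

    finitely-many-formulas : ∃[ L ] (∀ φ → Any (λ l → ∀ x → x ⊩[ M ] φ ⇔ x ⊩[ M ] l) L)
    finitely-many-formulas =
      let L , cover = representatives (λ r φ → r ⊩[ M ] φ) rs (λ _ → ⊤) in
      L , λ φ → Any.map (λ {l} (_ , agree) → agree⇒equivalent id {φ} {l} agree) (cover φ tt)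

    -- The p-morphism sending a point to its theory.

    private
      L = proj₁ finitely-many-formulas

      Th : ∀ x → Σ[ y ∈ Prime n ] (∀ φ → y ∋ φ ⇔ x ⊩[ M ] φ)
      Th x = toPrime (theoryOf M x) (λ ()) id

      th : Carrier → Prime n
      th = proj₁ ∘ Th

      module C = Model (Canonical n)

      th-mono : ∀ {x y} → x ⊑ y → th x C.≤ th y
      th-mono {x} {y} x⊑y φ = from (proj₂ (Th y) φ) ∘ persistent M φ x⊑y ∘ to (proj₂ (Th x) φ)

      -- Each `φ` is equivalent in `M` to some `l` in `L`, so `th x` contains both implications
      -- between them. Every prime filter above `th x` inherits these and is thus determined by its
      -- trace on `L`.
      agree-on-L : ∀ x y z → th x C.≤ y → th x C.≤ z →
                   Agree (λ l y → y ∋ l) L y z → y C.≈ z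
      agree-on-L x y z x≤y x≤z agree = (λ φ → to (y⇔z φ)) , (λ φ → from (y⇔z φ))
        where
        same : ∀ {φ l y} → th x C.≤ y → (∀ x → x ⊩[ M ] φ ⇔ x ⊩[ M ] l) → y ∋ φ ⇔ y ∋ l
        same {φ} {l} {y} x≤y φ~l = mk⇔
          (mp (filterTheory y) (x≤y (φ ⇒ l) (from (proj₂ (Th x) (φ ⇒ l)) (λ w _ → to (φ~l w)))))
          (mp (filterTheory y) (x≤y (l ⇒ φ) (from (proj₂ (Th x) (l ⇒ φ)) (λ w _ → from (φ~l w)))))
        y⇔z : ∀ φ → y ∋ φ ⇔ z ∋ φ
        y⇔z φ = let l , l∈ , φ~l = find (proj₂ finitely-many-formulas φ) in
          ⇔-sym (same {φ} {l} {z} x≤z φ~l) ⇔-∘ (All.lookup agree l∈ ⇔-∘ same {φ} {l} {y} x≤y φ~l)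

      -- `γ` conjoins the formulas of `Λ` lying in `y` and `δ` disjoins the others; primeness keeps
      -- `δ` out of `y`.
      characterise : ∀ y Λ → Σ[ γ ∈ Form n ] Σ[ δ ∈ Form n ] y ∋ γ × (¬ y ∋ δ) ×
                     (∀ x → x ⊩[ M ] γ → ¬ x ⊩[ M ] δ → All (λ l → x ⊩[ M ] l ⇔ y ∋ l) Λ)
      characterise y []      = ⊥̇ ⇒ ⊥̇ , ⊥̇ , PrimeFilter.⊤-mem y , PrimeFilter.⊥-nonmem y , λ _ _ _ → []
      characterise y (l ∷ Λ) with characterise y Λ | em {y ∋ l}
      ... | γ , δ , γ∈ , δ∉ , pins | yes l∈ =
        l ∧ γ , δ , PrimeFilter.∧-closed y l∈ γ∈ , δ∉ ,
        λ x (xl , xγ) ¬xδ → mk⇔ (λ _ → l∈) (λ _ → xl) ∷ pins x xγ ¬xδ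
      ... | γ , δ , γ∈ , δ∉ , pins | no l∉ =
        γ , l ∨ δ , γ∈ , [ l∉ , δ∉ ]′ ∘ PrimeFilter.prime y ,
        λ x xγ ¬x → mk⇔ (λ xl → contradiction (inj₁ xl) ¬x) (flip contradiction l∉) ∷
                    pins x xγ (¬x ∘ inj₂)

      -- If no point above `x` forced `γ` without `δ`, then `γ ⇒ δ` would lie in `th x`, hence in
      -- `y`, and bring `δ` into `y`. A point that does so has the trace of `y` on `L`, which
      -- suffices by `agree-on-L`.
      th-back : ∀ x y → th x C.≤ y → ∃[ x′ ] x ⊑ x′ × th x′ C.≈ y
      th-back x y x≤y =
        let γ , δ , γ∈ , δ∉ , pins = characterise y L
            x′ , x⊑x′ , x′γ , ¬x′δ = by-contradiction λ ∄ →
              δ∉ (mp (filterTheory y) (x≤y (γ ⇒ δ) (from (proj₂ (Th x) (γ ⇒ δ))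
                (λ w x⊑w wγ → by-contradiction λ ¬wδ → ∄ (w , x⊑w , wγ , ¬wδ)))) γ∈)
        in x′ , x⊑x′ , agree-on-L x (th x′) y (th-mono x⊑x′) x≤y
             (All.map (λ {l} e → e ⇔-∘ proj₂ (Th x′) l) (pins x′ x′γ ¬x′δ))

    theoryMorphism : PMorphism M (U n)
    theoryMorphism = record
      { homomorphism = mkPosetHomo _ _
          -- Distinct prime filters above `th x` have distinct traces on `L`, so the up-set of
          -- `th x` is finite in the whole canonical model, as `U n` demands.
          (λ x → th x , finite-of-agree (upsetSetoid (Canonical n) (th x)) (λ l (y , _) → y ∋ l) L
                          (λ {(y , x≤y)} {(z , x≤z)} → agree-on-L x y z x≤y x≤z))
          th-mono
      ; colour-pres  = λ x i → Bool-≡ (proj₂ (Th x) (p i))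
      ; back         = λ x (y , _) → th-back x y
      }
      where
      Bool-≡ : ∀ {a b} → (a ≡ true) ⇔ (b ≡ true) → a ≡ b
      Bool-≡ {true}          e = sym (to e refl)
      Bool-≡ {false} {true}  e = from e refl
      Bool-≡ {false} {false} e = refl

  -- The universal model and the free algebra.

  FiniteUp-upClosed : ∀ {n} → UpClosed (Canonical n) (FiniteUp (Canonical n))
  FiniteUp-upClosed {n} x y x≤y (zs , cover) =
    -- Some entries of `zs` may not lie above `y`, so the list itself cannot be reused; points above
    -- `y` are told apart by the entries they equal.
    finite-of-agree (upsetSetoid (Canonical n) y) (λ (z , _) (w , _) → w C.≈ z) zs
      λ {(w , y≤w)} {(w′ , _)} agree →
        let z , z∈ , w≈z = find (cover (w , C.trans {x} {y} {w} x≤y y≤w)) in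
        C.Eq.trans {w} {proj₁ z} {w′} w≈z (C.Eq.sym {w′} {proj₁ z} (to (All.lookup agree z∈) w≈z))
    where module C = Model (Canonical n)

  U-truth : ∀ φ (x : Model.Carrier (U n)) → x ⊩[ U n ] φ ⇔ proj₁ x ∋ φ
  U-truth = truth (FiniteUp (Canonical _)) FiniteUp-upClosed

  -- P-morphisms preserve forcing, and by `U-truth` a point of `U n` consists of exactly the
  -- formulas it forces.
  pmorphism-unique : ∀ {M : Model n} (f g : PMorphism M (U n)) → f ≗ᵖ g
  pmorphism-unique f g x = ⊆ f g , ⊆ g f
    where
    ⊆ : ∀ f g φ → proj₁ (PMorphism.⟦ f ⟧ x) ∋ φ → proj₁ (PMorphism.⟦ g ⟧ x) ∋ φ
    ⊆ f g φ = to (U-truth φ _) ∘ to (pmorphism-preserves g φ x)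
            ∘ from (pmorphism-preserves f φ x) ∘ from (U-truth φ _)

  entails-of-forces : (s t : Term n) →
                      (∀ x → x ⊩[ U n ˢ ] ⌜ s ⌝ → x ⊩[ U n ˢ ] ⌜ t ⌝) → ⌜ s ⌝ ∷ [] ⊢ ⌜ t ⌝
  entails-of-forces {n} s t valid = by-contradiction λ s⊬t →
    let y , s⊢⊆y , t∉y , _ = lindenbaum (consequences ⌜ s ⌝) ⌜ t ⌝ s⊬t
        open module C↾ = Model C
        y′ : Model.Carrier C
        y′ = y , tt
    in t∉y (to (C-truth ⌜ t ⌝ y′) (from (C-via-separated t y′) λ z y≤z →
         from (pmorphism-preserves π ⌜ t ⌝ z)
           (U-valid (PMorphism.⟦ π ⟧ z)
             (to (pmorphism-preserves π ⌜ s ⌝ z)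
               (to (C-via-separated s y′) (from (C-truth ⌜ s ⌝ y′) (s⊢⊆y ⌜ s ⌝ hyp₀)) z y≤z)))))
    where
    -- The whole canonical model, written as a restriction so that `truth` and `separated-above`
    -- apply. Its points may have infinite up-sets, but `theoryMorphism` asks only for
    -- `ColourIncreasing`.
    C = Canonical n ↾ λ _ → ⊤
    π = theoryMorphism (C ˢ) (separated-increasing C)
    C-truth = truth (λ _ → ⊤) (λ _ _ _ _ → tt)
    C-via-separated = forces-via-separated C (separated-above (λ _ → ⊤) (λ _ _ _ _ → tt))
    U-via-separated = forces-via-separated (U n)
      (separated-above (FiniteUp (Canonical n)) FiniteUp-upClosed)

    U-valid : ∀ u → u ⊩[ U n ] ⌜ s ⌝ → u ⊩[ U n ] ⌜ t ⌝
    U-valid u us = from (U-via-separated t u) λ w u≤w → valid w (to (U-via-separated s u) us w u≤w)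

  U-morphism : ∀ n → PMorphism (U n ˢ) (U n)
  U-morphism n = theoryMorphism (U n ˢ) (separated-increasing (U n))

  h-reflects-≤ : (s t : Term n) → let I = Image (U-morphism n) in
                 (∀ y → UpSet.Mem (Homomorphism.⟦_⟧ (h I) s) y →
                        UpSet.Mem (Homomorphism.⟦_⟧ (h I) t) y) →
                 ⌜ s ⌝ ∷ [] ⊢ ⌜ t ⌝
  h-reflects-≤ {n} s t hs⊆ht = entails-of-forces s t λ x →
    from (forced t x) ∘ hs⊆ht (PMorphism.⟦ f ⟧ x) ∘ to (forced s x)
    where
    f = corestrict (U-morphism n)
    forced : ∀ t x → x ⊩[ U n ˢ ] ⌜ t ⌝ ⇔ UpSet.Mem (Homomorphism.⟦_⟧ (h _) t) (PMorphism.⟦ f ⟧ x)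
    forced t x = ⇔-sym (h⇔forces _ t _) ⇔-∘ pmorphism-preserves f ⌜ t ⌝ x

  -- Counted directly on `U n ˢ` rather than through up-sets of the image: a term is determined up
  -- to equivalence by the representative points that force it.
  FreeIMS-finite : ∀ n → Finite (ImplicativeMeetSemilattice.setoid (FreeIMS n))
  FreeIMS-finite n =
    finite-of-agree (ImplicativeMeetSemilattice.setoid (FreeIMS n))
                    (λ r t → r ⊩[ M ] ⌜ t ⌝) (proj₁ (finitely-many-theories M inc))
    λ {s} {t} agree → let s⇔t = agree⇒equivalent M inc ⌜_⌝ {s} {t} agree in
      entails-of-forces s t (λ x → to (s⇔t x)) , entails-of-forces t s (λ x → from (s⇔t x))
    where
    M   = U n ˢ
    inc = separated-increasing (U n)

-- Local finiteness.

locally-finite : ∀ {c ℓ₁ ℓ₂} →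
                 (∀ n → Finite (ImplicativeMeetSemilattice.setoid (FreeIMS n))) →
                 LocallyFinite-IMS c ℓ₁ ℓ₂
locally-finite free-finite A (k , g , generates) =
  let ts , cover = free-finite k in
  map (evalTerm A g) ts , λ x →
    -- Every element of `A` is the value of a term, so `A` is a quotient of the finite algebra
    -- `FreeIMS k`.
    let t , t≈x = term (generates x) in
    Any.map⁺ (Any.map
      (λ {u} t≈u → Eq.trans (Eq.sym t≈x) (Homomorphism.cong (free-ext A g) {t} {u} t≈u))
      (cover t))
  where
  open ImplicativeMeetSemilattice A using
    (_≈_; exponential; reflexive; antisym; meetSemilattice; module Eq)
    renaming (_≤_ to _⊑_; _∧_ to _⊓_; _⇨_ to _⊸_; refl to ⊑-refl; trans to ⊑-trans)
  open MeetSemilatticeProperties meetSemilattice using (∧-monotonic; ∧-cong)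

  ⊸-mono : ∀ {w x y z} → x ⊑ w → y ⊑ z → w ⊸ y ⊑ x ⊸ z
  ⊸-mono x⊑w y⊑z = proj₁ (exponential _ _ _)
    (⊑-trans (∧-monotonic ⊑-refl x⊑w) (⊑-trans (proj₂ (exponential _ _ _) ⊑-refl) y⊑z))

  term : ∀ {x} → Generated A g x → ∃[ t ] evalTerm A g t ≈ x
  term (gen i)    = p i , Eq.refl
  term (meet a b) = let s , s≈ = term a ; t , t≈ = term b in s ∧ t , ∧-cong s≈ t≈
  term (impl a b) = let s , s≈ = term a ; t , t≈ = term b in s ⇒ t ,
    antisym (⊸-mono (reflexive (Eq.sym s≈)) (reflexive t≈))
            (⊸-mono (reflexive s≈) (reflexive (Eq.sym t≈)))
  term (resp e a) = let t , t≈ = term a in t , Eq.trans t≈ e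

theorem3p13 : (c ℓ₁ ℓ₂ : Level) → ExcludedMiddle 0ℓ →
    ((n : ℕ) →
    (Σ[ π ∈ PMorphism (U n ˢ) (U n) ]
    ((ρ : PMorphism (U n ˢ) (U n)) → ρ ≗ᵖ π) ×
    Injective (ImplicativeMeetSemilattice._≈_ (FreeIMS n))
    (HeytingAlgebra._≈_ (UpSets (Model.poset (Image π))))
    (Homomorphism.⟦_⟧ (h (Image π))))
    × Finite (ImplicativeMeetSemilattice.setoid (FreeIMS n)))
    × LocallyFinite-IMS c ℓ₁ ℓ₂
theorem3p13 c ℓ₁ ℓ₂ em =
  (λ n →
    ( U-morphism em n
    , (λ ρ → pmorphism-unique em ρ (U-morphism em n))
    , λ {s} {t} (hs⊆ht , ht⊆hs) → h-reflects-≤ em s t hs⊆ht , h-reflects-≤ em t s ht⊆hs)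
    , FreeIMS-finite em n) ,
  locally-finite (FreeIMS-finite em)
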